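{- Let $p$ be a prime, let $\mathcal{A}$ be a finite alphabet, let $\phi:\mathcal{A}\to\mathcal{A}^*$ be a morphism prolongable on a letter $a\in\mathcal{A}$, and let $w=\phi^\omega(a)\in\mathcal{A}^\omega$ be the resulting pure morphic word. Suppose that $w$ contains a subword of the form $uXuXu$, with $u\in\mathcal{A}$ and $X\in\mathcal{A}^*$, such that $\lim_{n\to\infty}|\phi^n(u)|=\infty$. Then for any non-erasing morphism $g:\mathcal{A}\to\{0,1,\ldots,p-1\}^*$, the real number $g(w)_p$ satisfies the $p$-adic Littlewood conjecture.
   Context: $\mathcal{A}^*$ is the set of finite words over $\mathcal{A}$, including the empty word $\epsilon$; $\mathcal{A}^\omega$ is the set of (right-)infinite words; $|v|$ is the length of a word $v$; subwords are blocks of consecutive letters. A morphism $\phi:\mathcal{A}\to\mathcal{B}^*$ is extended to words by concatenation; it is non-erasing if $\phi(c)\neq\epsilon$ for every letter $c$. Given a morphism $\phi:\mathcal{A}\to\mathcal{A}^*$, a letter $c$ is mortal if $\phi^j(c)=\epsilon$ for some $j\ge1$; $M_\phi$ is the set of mortal letters. The morphism $\phi$ is prolongable on $a\in\mathcal{A}$ if $\phi(a)=ax$ with $x\notin M_\phi^*$. In this case $a,\phi(a),\phi^2(a),\ldots$ converge to the infinite word $\phi^\omega(a)=ax\,\phi(x)\,\phi^2(x)\cdots$; words of this form are called pure morphic words. For an infinite word $v=a_1a_2\cdots$ on $\{0,1,\ldots,p-1\}$, $v_p=\sum_{n\ge1}a_np^{ -n}$. A real number $x$ satisfies the $p$-adic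 Littlewood conjecture (pLC) if $\liminf_{q\to\infty} q\cdot|q|_p\cdot\|qx\|=0$, where $q$ runs over the positive integers, $|\cdot|_p$ is the $p$-adic absolute value and $\|\cdot\|$ is the distance to the nearest integer. -}

module Defs where

open import Data.Nat as ℕ using (ℕ; zero; suc; z≤n; s≤s)
import Data.Nat.Properties as ℕ
import Data.Nat.Coprimality as Coprime
open import Data.Nat.Divisibility using (_∣_; _∣?_; divides; 1∣_; *-monoˡ-∣; *-cancelʳ-∣)
open import Data.Nat.Induction using (<-wellFounded)
open import Data.Nat.Primality using (Prime; prime⇒nonZero; prime⇒nonTrivial)
open import Data.Nat.GeneralisedArithmetic using (fold)
open import Data.Integer as ℤ using (ℤ; +_; -[1+_])
import Data.Integer.Properties as ℤ
import Data.Integer.DivMod as ℤ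
open import Data.Rational as ℚ
  using (ℚ; mkℚ; 0ℚ; 1ℚ; ½; _+_; _*_; _-_; -_; _≤_; _<_; _/_; ∣_∣; round; floor; ceiling; ↧ₙ_; toℚᵘ; *≤*; *<*; 1/_; Positive)
import Data.Rational.Properties as ℚ
open import Data.Rational.Unnormalised as ℚᵘ using (mkℚᵘ)
import Data.Rational.Unnormalised.Properties as ℚᵘ
open import Data.Rational.Solver using (module +-*-Solver)
open import Data.Fin using (Fin; toℕ; fromℕ<)
open import Data.Fin.Properties using (toℕ<n)
open import Data.List using (List; []; _∷_; [_]; _++_; length; lookup; concat; concatMap; applyUpTo)
open import Data.List.Properties
  using (concatMap-++; length-++; ++-conicalˡ; ++-conicalʳ; applyUpTo-∷ʳ; concat-++; ++-identityʳ)
open import Data.List.Relation.Unary.All using (All; []; _∷_)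
open import Data.Product using (∃-syntax; _×_; _,_; proj₁; proj₂)
open import Data.Sum using (inj₁; inj₂)
open import Data.Bool using (true; false)
open import Function using (_∘_)
open import Induction.WellFounded using (Acc; acc)
open import Relation.Nullary using (¬_; yes; no; contradiction)
open import Relation.Binary.PropositionalEquality
  using (_≡_; _≢_; refl; sym; trans; cong; cong₂; subst; subst₂; module ≡-Reasoning)

private variable
  A B : Set

------------------------------------------------------------------------
-- Words and morphisms

Word : Set → Set
Word = List

InfWord : Set → Set
InfWord A = ℕ → A

Subword : Word A → InfWord A → Set
Subword v w = ∃[ i ] applyUpTo (λ j → w (i ℕ.+ j)) (length v) ≡ v

Morphism : Set → Set → Set
Morphism A B = A → Word B

NonErasing : Morphism A B → Set
NonErasing g = ∀ c → g c ≢ []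

_^⟨_⟩_ : Morphism A A → ℕ → Word A → Word A
φ ^⟨ n ⟩ v = fold v (concatMap φ) n

Mortal : Morphism A A → A → Set
Mortal φ c = ∃[ j ] (1 ℕ.≤ j × φ ^⟨ j ⟩ [ c ] ≡ [])

Prolongable : Morphism A A → A → Set
Prolongable φ a = ∃[ x ] (φ a ≡ a ∷ x × ¬ All (Mortal φ) x)

TendsToInfinity : (ℕ → ℕ) → Set
TendsToInfinity f = ∀ K → ∃[ N ] ∀ n → N ℕ.≤ n → K ℕ.≤ f n

length-concat : (b : ℕ → Word A) → (∀ n → b n ≢ []) →
                ∀ n → n ℕ.≤ length (concat (applyUpTo b n))
length-concat b ne zero    = z≤n
length-concat b ne (suc n) with b 0 in eq
... | []     = contradiction eq (ne 0)
... | c ∷ cs = s≤s (ℕ.≤-trans (length-concat (b ∘ suc) (ne ∘ suc) n)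
  (subst (length (concat (applyUpTo (b ∘ suc) n)) ℕ.≤_)
         (sym (length-++ cs)) (ℕ.m≤n+m _ (length cs))))

-- The infinite concatenation b₀ b₁ b₂ ⋯ of non-empty blocks.  Its i-th letter
-- (counting from 0) already occurs in b₀ ⋯ bᵢ, as every block has a letter.
concatω : (b : ℕ → Word A) → (∀ n → b n ≢ []) → InfWord A
concatω b ne i =
  lookup (concat (applyUpTo b (suc i))) (fromℕ< (length-concat b ne (suc i)))

image : (g : Morphism A B) → NonErasing g → InfWord A → InfWord B
image g ne w = concatω (g ∘ w) (ne ∘ w)

^⟨⟩-++ : (φ : Morphism A A) → ∀ n xs ys →
         φ ^⟨ n ⟩ (xs ++ ys) ≡ φ ^⟨ n ⟩ xs ++ φ ^⟨ n ⟩ ys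
^⟨⟩-++ φ zero    xs ys = refl
^⟨⟩-++ φ (suc n) xs ys =
  trans (cong (concatMap φ) (^⟨⟩-++ φ n xs ys)) (concatMap-++ φ (φ ^⟨ n ⟩ xs) _)

erased⇒mortal : (φ : Morphism A A) → ∀ n x → φ ^⟨ n ⟩ x ≡ [] → All (Mortal φ) x
erased⇒mortal φ n       []       eq = []
erased⇒mortal φ (suc n) (c ∷ cs) eq =
  (suc n , s≤s z≤n , ++-conicalˡ _ _ eq′) ∷ erased⇒mortal φ (suc n) cs (++-conicalʳ _ _ eq′)
  where eq′ = trans (sym (^⟨⟩-++ φ (suc n) [ c ] cs)) eq

blocks : Morphism A A → A → Word A → ℕ → Word A
blocks φ a x zero    = [ a ]
blocks φ a x (suc n) = φ ^⟨ n ⟩ x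

blocks-nonEmpty : (φ : Morphism A A) → ∀ a x → ¬ All (Mortal φ) x →
                  ∀ n → blocks φ a x n ≢ []
blocks-nonEmpty φ a x imm zero    ()
blocks-nonEmpty φ a x imm (suc n) eq = imm (erased⇒mortal φ n x eq)

-- φ^ω(a) = a x φ(x) φ²(x) ⋯
pureMorphic : (φ : Morphism A A) (a : A) → Prolongable φ a → InfWord A
pureMorphic φ a (x , _ , imm) = concatω (blocks φ a x) (blocks-nonEmpty φ a x imm)

-- The words φⁿ(a) = a x φ(x) ⋯ φⁿ⁻¹(x) converge to pureMorphic φ a.
iterates-converge : (φ : Morphism A A) → ∀ a x → φ a ≡ a ∷ x → ∀ n →
                    φ ^⟨ n ⟩ [ a ] ≡ concat (applyUpTo (blocks φ a x) (suc n))
iterates-converge φ a x eq zero    = refl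
iterates-converge φ a x eq (suc n) = begin
  φ ^⟨ suc n ⟩ [ a ]                               ≡⟨ shift n [ a ] ⟩
  φ ^⟨ n ⟩ (φ a ++ [])                             ≡⟨ cong (φ ^⟨ n ⟩_) (trans (++-identityʳ _) eq) ⟩
  φ ^⟨ n ⟩ ([ a ] ++ x)                            ≡⟨ ^⟨⟩-++ φ n [ a ] x ⟩
  φ ^⟨ n ⟩ [ a ] ++ φ ^⟨ n ⟩ x                     ≡⟨ cong₂ _++_ (iterates-converge φ a x eq n) (sym (++-identityʳ _)) ⟩
  concat (applyUpTo b (suc n)) ++ concat [ b (suc n) ] ≡⟨ concat-++ (applyUpTo b (suc n)) _ ⟩
  concat (applyUpTo b (suc n) ++ [ b (suc n) ])    ≡⟨ cong concat (applyUpTo-∷ʳ b (suc n)) ⟩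
  concat (applyUpTo b (suc (suc n)))               ∎
  where
  open ≡-Reasoning
  b = blocks φ a x
  shift : ∀ n v → φ ^⟨ suc n ⟩ v ≡ φ ^⟨ n ⟩ concatMap φ v
  shift zero    v = refl
  shift (suc n) v = cong (concatMap φ) (shift n v)

------------------------------------------------------------------------
-- Real numbers: Cauchy sequences of rationals with an explicit modulus

record ℝ : Set where
  field
    approx : ℕ → ℚ
    cauchy : ∀ ε → 0ℚ < ε → ∃[ N ] ∀ m n → N ℕ.≤ m → N ℕ.≤ n →
             ∣ approx m - approx n ∣ ≤ ε
open ℝ public

infix 4 _<ℝ_ _≤ℝ_

_<ℝ_ : ℝ → ℝ → Set
x <ℝ y = ∃[ ε ] (0ℚ < ε × ∃[ N ] ∀ n → N ℕ.≤ n → approx x n + ε ≤ approx y n)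

_≤ℝ_ : ℝ → ℝ → Set
x ≤ℝ y = ¬ (y <ℝ x)

0ℝ : ℝ
0ℝ .approx _ = 0ℚ
0ℝ .cauchy ε 0<ε = 0 , λ _ _ _ _ → ℚ.<⇒≤ 0<ε

module _ {I : Set} (f : I → ℝ) (L : ℝ) where

  -- Constructively, "greatest" lower bound means that every y > L fails to be
  -- a lower bound with a witness.
  IsInfimum : Set
  IsInfimum = (∀ i → L ≤ℝ f i) × (∀ y → L <ℝ y → ∃[ i ] f i <ℝ y)

  IsSupremum : Set
  IsSupremum = (∀ i → f i ≤ℝ L) × (∀ y → y <ℝ L → ∃[ i ] y <ℝ f i)

-- lim inf s = sup_N inf_{n ≥ N} sₙ
IsLiminf : (ℕ → ℝ) → ℝ → Set
IsLiminf s L =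
  ∃[ inf ] ((∀ N → IsInfimum (λ j → s (N ℕ.+ j)) (inf N)) × IsSupremum inf L)

infixr 7 _·_

_·_ : ℚ → ℝ → ℝ
(c · x) .approx n = c * approx x n
(c · x) .cauchy ε 0<ε = N , λ m n N≤m N≤n → begin
  ∣ c * approx x m - c * approx x n ∣   ≡⟨ cong ∣_∣ (distrib c (approx x m) (approx x n)) ⟩
  ∣ c * (approx x m - approx x n) ∣     ≡⟨ ℚ.∣p*q∣≡∣p∣*∣q∣ c _ ⟩
  ∣ c ∣ * ∣ approx x m - approx x n ∣   ≤⟨ ℚ.*-monoˡ-≤-nonNeg ∣ c ∣ {{ℚ.∣-∣-nonNeg c}} (close m n N≤m N≤n) ⟩
  ∣ c ∣ * δ                             ≤⟨ ℚ.*-monoʳ-≤-nonNeg δ {{ℚ.pos⇒nonNeg δ}} c≤C ⟩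
  C * δ                                 ≡⟨ cancel ⟩
  ε                                     ∎
  where
  open ℚ.≤-Reasoning
  open +-*-Solver
  C = ∣ c ∣ + 1ℚ
  c≤C : ∣ c ∣ ≤ C
  c≤C = subst (_≤ C) (ℚ.+-identityʳ ∣ c ∣) (ℚ.+-monoʳ-≤ ∣ c ∣ (*≤* (ℤ.+≤+ z≤n)))
  instance
    C-pos : Positive C
    C-pos = ℚ.positive (ℚ.<-≤-trans (*<* (ℤ.+<+ (s≤s z≤n)))
              (subst (_≤ C) (ℚ.+-identityˡ 1ℚ) (ℚ.+-monoˡ-≤ 1ℚ (ℚ.0≤∣p∣ c))))
    C-nonZero : ℚ.NonZero C
    C-nonZero = ℚ.pos⇒nonZero C
    1/C-pos : Positive (1/ C)
    1/C-pos = ℚ.1/pos⇒pos C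
    ε-pos : Positive ε
    ε-pos = ℚ.positive 0<ε
  δ = ε * 1/ C
  instance
    δ-pos : Positive δ
    δ-pos = ℚ.positive (subst (_< δ) (ℚ.*-zeroˡ (1/ C)) (ℚ.*-monoˡ-<-pos (1/ C) 0<ε))
  cancel : C * δ ≡ ε
  cancel = trans (trans (ℚ.*-comm C δ) (ℚ.*-assoc ε (1/ C) C))
                 (trans (cong (ε *_) (ℚ.*-inverseˡ C)) (ℚ.*-identityʳ ε))
  distrib : ∀ c a b → c * a - c * b ≡ c * (a - b)
  distrib = solve 3 (λ c a b → c :* a :- c :* b := c :* (a :- b)) refl
  N     = proj₁ (cauchy x δ (ℚ.positive⁻¹ δ))
  close = proj₂ (cauchy x δ (ℚ.positive⁻¹ δ))

------------------------------------------------------------------------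
-- Distance to the nearest integer

‖_‖ℚ : ℚ → ℚ
‖ r ‖ℚ = ∣ r - round r / 1 ∣

/1 : ∀ z → z / 1 ≡ mkℚ z 0 (Coprime.sym (Coprime.1-coprimeTo ℤ.∣ z ∣))
/1 z = ℚ.fromℚᵘ-toℚᵘ (mkℚ z 0 _)

/1-+ : ∀ y z → (y ℤ.+ z) / 1 ≡ y / 1 + z / 1
/1-+ y z rewrite /1 y | /1 z = cong (_/ 1) (sym (cong₂ ℤ._+_ (ℤ.*-identityʳ y) (ℤ.*-identityʳ z)))

/1-neg : ∀ z → (ℤ.- z) / 1 ≡ - (z / 1)
/1-neg z rewrite /1 z | /1 (ℤ.- z) with z
... | + zero   = refl
... | + suc _  = refl
... | -[1+ _ ] = refl

floor-lower : ∀ r → floor r / 1 ≤ r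
floor-lower r@(mkℚ n d _) rewrite /1 (floor r) = *≤*
  (subst (floor r ℤ.* + suc d ℤ.≤_) (sym (ℤ.*-identityʳ n)) (ℤ.[n/d]*d≤n n (+ suc d)))

floor-upper : ∀ r → r ≤ floor r / 1 + 1ℚ
floor-upper r@(mkℚ n d _) rewrite sym (/1-+ (floor r) (+ 1)) | /1 (floor r ℤ.+ + 1) = *≤*
  (subst₂ ℤ._≤_ (sym (ℤ.*-identityʳ n))
    (cong (ℤ._* + suc d) (trans (cong ℤ.suc (sym (ℤ.div-pos-is-/ℕ n (suc d)))) (ℤ.+-comm (+ 1) (floor r))))
    (ℤ.<⇒≤ (ℤ.n<s[n/ℕd]*d n (suc d))))

ceiling-def : ∀ r → ceiling r ≡ ℤ.- floor (- r)
ceiling-def (mkℚ _ _ _) = refl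

abs-≤ : ∀ {x b} → x ≤ b → - x ≤ b → ∣ x ∣ ≤ b
abs-≤ {x} x≤b -x≤b with ℚ.∣p∣≡p∨∣p∣≡-p x
... | inj₁ eq = subst (_≤ _) (sym eq) x≤b
... | inj₂ eq = subst (_≤ _) (sym eq) -x≤b

x≤∣x∣ : ∀ x → x ≤ ∣ x ∣
x≤∣x∣ x with ℚ.≤-total 0ℚ x
... | inj₁ 0≤x = ℚ.≤-reflexive (sym (ℚ.0≤p⇒∣p∣≡p 0≤x))
... | inj₂ x≤0 = ℚ.≤-trans x≤0 (ℚ.0≤∣p∣ x)

∣x-y∣≡∣y-x∣ : ∀ x y → ∣ x - y ∣ ≡ ∣ y - x ∣
∣x-y∣≡∣y-x∣ x y = trans (sym (ℚ.∣-p∣≡∣p∣ (x - y)))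
  (cong ∣_∣ (solve 2 (λ x y → :- (x :- y) := y :- x) refl x y))
  where open +-*-Solver

triangle : ∀ x y z → ∣ x - z ∣ ≤ ∣ x - y ∣ + ∣ y - z ∣
triangle x y z = subst (λ t → ∣ t ∣ ≤ ∣ x - y ∣ + ∣ y - z ∣)
  (solve 3 (λ x y z → (x :- y) :+ (y :- z) := x :- z) refl x y z)
  (ℚ.∣p+q∣≤∣p∣+∣q∣ (x - y) (y - z))
  where open +-*-Solver

‖‖≤½ : ∀ r → ‖ r ‖ℚ ≤ ½
‖‖≤½ r with r ℚ.≤ᵇ 0ℚ
... | false = abs-≤
  (subst₂ _≤_ (lhs r f) (rhs f) (ℚ.+-monoˡ-≤ (- f - ½) (floor-upper (r + ½))))
  (subst₂ _≤_ (lhs′ r f) (rhs′ r) (ℚ.+-monoˡ-≤ (- r) (floor-lower (r + ½))))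
  where
  open +-*-Solver
  f = floor (r + ½) / 1
  lhs : ∀ r f → (r + ½) + (- f - ½) ≡ r - f
  lhs = solve 2 (λ r f → (r :+ con ½) :+ (:- f :- con ½) := r :- f) refl
  rhs : ∀ f → (f + 1ℚ) + (- f - ½) ≡ ½
  rhs = solve 1 (λ f → (f :+ con 1ℚ) :+ (:- f :- con ½) := con ½) refl
  lhs′ : ∀ r f → f + - r ≡ - (r - f)
  lhs′ = solve 2 (λ r f → f :+ :- r := :- (r :- f)) refl
  rhs′ : ∀ r → (r + ½) + - r ≡ ½
  rhs′ = solve 1 (λ r → (r :+ con ½) :+ :- r := con ½) refl
... | true rewrite ceiling-def (r - ½) | /1-neg (floor (- (r - ½))) = abs-≤
  (subst₂ _≤_ (lhs r f) (rhs r) (ℚ.+-monoˡ-≤ r (floor-lower (- (r - ½)))))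
  (subst₂ _≤_ (lhs′ r f) (rhs′ f) (ℚ.+-monoˡ-≤ (- f - ½) (floor-upper (- (r - ½)))))
  where
  open +-*-Solver
  f = floor (- (r - ½)) / 1
  lhs : ∀ r f → f + r ≡ r - - f
  lhs = solve 2 (λ r f → f :+ r := r :- (:- f)) refl
  rhs : ∀ r → - (r - ½) + r ≡ ½
  rhs = solve 1 (λ r → :- (r :- con ½) :+ r := con ½) refl
  lhs′ : ∀ r f → - (r - ½) + (- f - ½) ≡ - (r - - f)
  lhs′ = solve 2 (λ r f → :- (r :- con ½) :+ (:- f :- con ½) := :- (r :- (:- f))) refl
  rhs′ : ∀ f → (f + 1ℚ) + (- f - ½) ≡ ½
  rhs′ = solve 1 (λ f → (f :+ con 1ℚ) :+ (:- f :- con ½) := con ½) refl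

1≤∣z∣ : ∀ z → z ≢ + 0 → 1ℚ ≤ ∣ z / 1 ∣
1≤∣z∣ z z≢0 rewrite /1 z with z
... | + zero   = contradiction refl z≢0
... | + suc _  = *≤* (ℤ.+≤+ (s≤s z≤n))
... | -[1+ _ ] = *≤* (ℤ.+≤+ (s≤s z≤n))

‖‖-nearest : ∀ r z → ‖ r ‖ℚ ≤ ∣ r - z / 1 ∣
‖‖-nearest r z with round r ℤ.≟ z
... | yes refl = ℚ.≤-refl
... | no  m≢z  = ℚ.≤-trans (‖‖≤½ r)
  (subst₂ _≤_ refl (cancel ∣ r - z / 1 ∣) (ℚ.+-monoʳ-≤ (- ½) (begin
    1ℚ                              ≤⟨ 1≤∣z∣ (round r ℤ.- z) (m≢z ∘ ℤ.i-j≡0⇒i≡j (round r) z) ⟩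
    ∣ (round r ℤ.- z) / 1 ∣         ≡⟨ cong ∣_∣ (trans (/1-+ (round r) (ℤ.- z)) (cong (λ t → round r / 1 + t) (/1-neg z))) ⟩
    ∣ round r / 1 - z / 1 ∣         ≤⟨ triangle (round r / 1) r (z / 1) ⟩
    ∣ round r / 1 - r ∣ + ∣ r - z / 1 ∣ ≡⟨ cong (_+ ∣ r - z / 1 ∣) (∣x-y∣≡∣y-x∣ (round r / 1) r) ⟩
    ‖ r ‖ℚ + ∣ r - z / 1 ∣          ≤⟨ ℚ.+-monoˡ-≤ _ (‖‖≤½ r) ⟩
    ½ + ∣ r - z / 1 ∣               ∎)))
  where
  open ℚ.≤-Reasoning
  open +-*-Solver
  cancel : ∀ t → - ½ + (½ + t) ≡ t
  cancel = solve 1 (λ t → :- con ½ :+ (con ½ :+ t) := t) refl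

‖‖-lipschitz : ∀ x y → ∣ ‖ x ‖ℚ - ‖ y ‖ℚ ∣ ≤ ∣ x - y ∣
‖‖-lipschitz x y = abs-≤ (half x y)
  (subst₂ _≤_ (swap ‖ y ‖ℚ ‖ x ‖ℚ) (∣x-y∣≡∣y-x∣ y x) (half y x))
  where
  open +-*-Solver
  swap : ∀ a b → a - b ≡ - (b - a)
  swap = solve 2 (λ a b → a :- b := :- (b :- a)) refl
  half : ∀ x y → ‖ x ‖ℚ - ‖ y ‖ℚ ≤ ∣ x - y ∣
  half x y = subst (‖ x ‖ℚ - ‖ y ‖ℚ ≤_)
    (solve 2 (λ a b → (a :+ b) :- b := a) refl ∣ x - y ∣ ‖ y ‖ℚ)
    (ℚ.+-monoˡ-≤ (- ‖ y ‖ℚ)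
      (ℚ.≤-trans (‖‖-nearest x (round y)) (triangle x y (round y / 1))))

-- The continuous extension of ‖_‖ℚ, which is 1-Lipschitz.
‖_‖ : ℝ → ℝ
‖ x ‖ .approx n = ‖ approx x n ‖ℚ
‖ x ‖ .cauchy ε 0<ε = let N , close = cauchy x ε 0<ε in
  N , λ m n N≤m N≤n → ℚ.≤-trans (‖‖-lipschitz (approx x m) (approx x n)) (close m n N≤m N≤n)

------------------------------------------------------------------------
-- Base-p expansions

module Expansion {p : ℕ} (p-prime : Prime p) where
  private instance
    p≢0 : ℕ.NonZero p
    p≢0 = prime⇒nonZero p-prime

  p^≢0 : ∀ n → ℕ.NonZero (p ℕ.^ n)
  p^≢0 n = ℕ.m^n≢0 p n

  -- Letters are indexed from 0, so v n is the digit a_{n+1}.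
  partialSum : InfWord (Fin p) → ℕ → ℚ
  partialSum v zero    = 0ℚ
  partialSum v (suc n) = partialSum v n + (+ toℕ (v n) / p ℕ.^ suc n) {{p^≢0 (suc n)}}

  p^-_ : ℕ → ℚ
  p^- n = (+ 1 / p ℕ.^ n) {{p^≢0 n}}

  frac : ∀ a b .{{_ : ℕ.NonZero b}} → toℚᵘ (+ a / b) ℚᵘ.≃ (+ a ℚᵘ./ b)
  frac a (suc b) = ℚ.toℚᵘ-fromℚᵘ (mkℚᵘ (+ a) b)

  frac-step : ∀ a b d .{{_ : ℕ.NonZero b}} .{{_ : ℕ.NonZero d}} →
              b ≡ p ℕ.* d → suc a ℕ.≤ p → + a / b + + 1 / b ≤ + 1 / d
  frac-step a b@(suc b-1) d@(suc d-1) eq a<p = ℚ.toℚᵘ-cancel-≤ (begin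
    toℚᵘ (+ a / b + + 1 / b)            ≃⟨ ℚ.toℚᵘ-homo-+ (+ a / b) (+ 1 / b) ⟩
    toℚᵘ (+ a / b) ℚᵘ.+ toℚᵘ (+ 1 / b)  ≃⟨ ℚᵘ.+-cong (frac a b) (frac 1 b) ⟩
    (+ a ℚᵘ./ b) ℚᵘ.+ (+ 1 ℚᵘ./ b)      ≤⟨ ℚᵘ.*≤* (subst₂ ℤ._≤_ lhs rhs (ℤ.+≤+ main)) ⟩
    + 1 ℚᵘ./ d                          ≃⟨ frac 1 d ⟨
    toℚᵘ (+ 1 / d)                      ∎)
    where
    open ℚᵘ.≤-Reasoning
    main : (a ℕ.* b ℕ.+ 1 ℕ.* b) ℕ.* d ℕ.≤ 1 ℕ.* (b ℕ.* b)
    main = subst₂ ℕ._≤_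
      (trans (cong (ℕ._* (b ℕ.* d)) (ℕ.+-comm 1 a))
        (trans (sym (ℕ.*-assoc (a ℕ.+ 1) b d)) (cong (ℕ._* d) (ℕ.*-distribʳ-+ b a 1))))
      (trans (trans (cong (p ℕ.*_) (ℕ.*-comm b d)) (sym (ℕ.*-assoc p d b)))
        (trans (cong (ℕ._* b) (sym eq)) (sym (ℕ.*-identityˡ (b ℕ.* b)))))
      (ℕ.*-monoˡ-≤ (b ℕ.* d) a<p)
    lhs : + ((a ℕ.* b ℕ.+ 1 ℕ.* b) ℕ.* d) ≡ (+ a ℤ.* + b ℤ.+ + 1 ℤ.* + b) ℤ.* + d
    lhs = trans (ℤ.pos-* (a ℕ.* b ℕ.+ 1 ℕ.* b) d)
      (cong (ℤ._* + d) (trans (ℤ.pos-+ (a ℕ.* b) (1 ℕ.* b)) (cong₂ ℤ._+_ (ℤ.pos-* a b) (ℤ.pos-* 1 b))))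
    rhs : + (1 ℕ.* (b ℕ.* b)) ≡ + 1 ℤ.* + (b ℕ.* b)
    rhs = ℤ.pos-* 1 (b ℕ.* b)

  frac-nonNeg : ∀ a b .{{_ : ℕ.NonZero b}} → 0ℚ ≤ + a / b
  frac-nonNeg a b = ℚ.nonNegative⁻¹ (+ a / b) {{ℚ.normalize-nonNeg a b}}

  increasing : ∀ v m k → partialSum v m ≤ partialSum v (k ℕ.+ m)
  increasing v m zero    = ℚ.≤-refl
  increasing v m (suc k) = ℚ.≤-trans (increasing v m k)
    (subst (_≤ partialSum v (suc k ℕ.+ m)) (ℚ.+-identityʳ _)
      (ℚ.+-monoʳ-≤ (partialSum v (k ℕ.+ m)) (frac-nonNeg (toℕ (v (k ℕ.+ m))) (p ℕ.^ suc (k ℕ.+ m)) {{p^≢0 (suc (k ℕ.+ m))}})))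

  decreasing : ∀ v m k → partialSum v (k ℕ.+ m) + p^- (k ℕ.+ m) ≤ partialSum v m + p^- m
  decreasing v m zero    = ℚ.≤-refl
  decreasing v m (suc k) = ℚ.≤-trans
    (subst (_≤ partialSum v (k ℕ.+ m) + p^- (k ℕ.+ m))
      (sym (ℚ.+-assoc (partialSum v (k ℕ.+ m)) _ (p^- (suc k ℕ.+ m))))
      (ℚ.+-monoʳ-≤ (partialSum v (k ℕ.+ m))
        (frac-step (toℕ (v (k ℕ.+ m))) (p ℕ.^ suc (k ℕ.+ m)) (p ℕ.^ (k ℕ.+ m)) {{p^≢0 (suc (k ℕ.+ m))}} {{p^≢0 (k ℕ.+ m)}} refl (toℕ<n (v (k ℕ.+ m))))))
    (decreasing v m k)

  bounds : ∀ v {N n} → N ℕ.≤ n →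
           partialSum v N ≤ partialSum v n × partialSum v n ≤ partialSum v N + p^- N
  bounds v {N} {n} N≤n = subst
    (λ n → partialSum v N ≤ partialSum v n × partialSum v n ≤ partialSum v N + p^- N)
    (ℕ.m∸n+n≡m N≤n)
    ( increasing v N k
    , ℚ.≤-trans
        (subst (_≤ partialSum v (k ℕ.+ N) + p^- (k ℕ.+ N)) (ℚ.+-identityʳ _)
          (ℚ.+-monoʳ-≤ (partialSum v (k ℕ.+ N)) (frac-nonNeg 1 (p ℕ.^ (k ℕ.+ N)) {{p^≢0 (k ℕ.+ N)}})))
        (decreasing v N k))
    where k = n ℕ.∸ N

  spread : ∀ {s e x y} → s ≤ x → y ≤ s + e → y - x ≤ e
  spread {s} {e} {x} {y} s≤x y≤s+e = subst (y - x ≤_)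
    (solve 2 (λ s e → (s :+ e) :- s := e) refl s e)
    (ℚ.+-mono-≤ y≤s+e (ℚ.neg-antimono-≤ s≤x))
    where open +-*-Solver

  n≤p^n : ∀ n → n ℕ.≤ p ℕ.^ n
  n≤p^n zero    = z≤n
  n≤p^n (suc n) = ℕ.≤-trans (s≤s (n≤p^n n))
    (ℕ.^-monoʳ-< p (ℕ.nonTrivial⇒n>1 p {{prime⇒nonTrivial p-prime}}) (ℕ.≤-refl {suc n}))

  small : ∀ ε → 0ℚ < ε → p^- (↧ₙ ε) ≤ ε
  small ε@(mkℚ (+ suc a) d c) 0<ε = ℚ.toℚᵘ-cancel-≤
    (ℚᵘ.≤-respˡ-≃ (ℚᵘ.≃-sym (frac 1 (p ℕ.^ suc d) {{p^≢0 (suc d)}})) (aux (p ℕ.^ suc d) {{p^≢0 (suc d)}} (n≤p^n (suc d))))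
    where
    aux : ∀ b .{{_ : ℕ.NonZero b}} → suc d ℕ.≤ b → (+ 1 ℚᵘ./ b) ℚᵘ.≤ mkℚᵘ (+ suc a) d
    aux (suc b-1) d≤b = ℚᵘ.*≤* (subst₂ ℤ._≤_ (ℤ.pos-* 1 (suc d)) (ℤ.pos-* (suc a) (suc b-1))
      (ℤ.+≤+ (ℕ.*-mono-≤ {1} {suc a} (s≤s z≤n) d≤b)))
  small (mkℚ (+ zero)   d c) 0<ε = contradiction (ℚ.positive 0<ε) λ ()
  small (mkℚ (-[1+ _ ]) d c) 0<ε = contradiction (ℚ.positive 0<ε) λ ()

  -- v_p = Σ_{n≥1} a_n p^{-n}
  value : InfWord (Fin p) → ℝ
  value v .approx = partialSum v
  value v .cauchy ε 0<ε = N , λ m n N≤m N≤n → ℚ.≤-trans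
    (abs-≤ (spread (proj₁ (bounds v N≤n)) (proj₂ (bounds v N≤m)))
           (subst (_≤ p^- N) (swap (partialSum v n) (partialSum v m))
             (spread (proj₁ (bounds v N≤m)) (proj₂ (bounds v N≤n)))))
    (small ε 0<ε)
    where
    open +-*-Solver
    N = ↧ₙ ε
    swap : ∀ a b → a - b ≡ - (b - a)
    swap = solve 2 (λ a b → a :- b := :- (b :- a)) refl

------------------------------------------------------------------------
-- The p-adic Littlewood conjecture

module Littlewood {p : ℕ} (p-prime : Prime p) where
  private instance
    p≢0 : ℕ.NonZero p
    p≢0 = prime⇒nonZero p-prime

  valuation : ∀ q → .{{ℕ.NonZero q}} → ∃[ k ] (p ℕ.^ k ∣ q × ¬ (p ℕ.^ suc k ∣ q))
  valuation q = go q (<-wellFounded q)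
    where
    go : ∀ q → Acc ℕ._<_ q → .{{ℕ.NonZero q}} → ∃[ k ] (p ℕ.^ k ∣ q × ¬ (p ℕ.^ suc k ∣ q))
    go q (acc rec) with p ∣? q
    ... | no p∤q = 0 , 1∣ q , λ p¹∣q → p∤q (subst (_∣ q) (ℕ.*-identityʳ p) p¹∣q)
    ... | yes (divides (suc q′) refl) =
      let k , p^k∣q′ , p^k+1∤q′ = go (suc q′) (rec (ℕ.m<m*n (suc q′) p (ℕ.nonTrivial⇒n>1 p {{prime⇒nonTrivial p-prime}})))
      in suc k
       , subst (_∣ suc q′ ℕ.* p) (ℕ.*-comm (p ℕ.^ k) p) (*-monoˡ-∣ p p^k∣q′)
       , λ d → p^k+1∤q′ (*-cancelʳ-∣ p (subst (_∣ suc q′ ℕ.* p) (ℕ.*-comm p (p ℕ.^ suc k)) d))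

  ∣_∣ₚ : (q : ℕ) → .{{ℕ.NonZero q}} → ℚ
  ∣ q ∣ₚ = let k , _ = valuation q in (+ 1 / p ℕ.^ k) {{ℕ.m^n≢0 p k}}

  littlewoodTerm : ℝ → (q : ℕ) → .{{ℕ.NonZero q}} → ℝ
  littlewoodTerm x q = (+ q / 1) · ∣ q ∣ₚ · ‖ (+ q / 1) · x ‖

  SatisfiesPLC : ℝ → Set
  SatisfiesPLC x = IsLiminf (λ j → littlewoodTerm x (suc j)) 0ℝ

open Expansion public using (value)
open Littlewood public using (SatisfiesPLC)

{-# OPTIONS --safe #-}
-- Write w = V u X u X u ⋯ and apply h = g ∘ φⁿ: as φ fixes w, g(w) begins with h(V) h(u) h(X) h(u) h(X) h(u).
-- Put r = |h(V)|, l = |h(u X)|, m = |h(u)| and q = pʳ(pˡ − 1), and let x = g(w)_p.  The fractional parts of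
-- pʳx and pʳ⁺ˡx share their first l + m digits, so ‖q x‖ ≤ p^-(l+m), while q ∣q∣ₚ ≤ pˡ.  The term at q is thus
-- at most p^-m, and m ≥ |φⁿ(u)| tends to infinity with n.

module Submission where

open import Defs
open import Data.Nat as ℕ using (ℕ; zero; suc; z≤n; s≤s; s<s; z<s; s<s⁻¹)
import Data.Nat.Properties as ℕ
import Data.Nat.Divisibility as ℕ
import Data.Nat.Solver as ℕ
open import Data.Nat.GeneralisedArithmetic using (fold-+)
open import Data.Nat.Primality using (Prime; prime⇒nonZero)
open import Data.Integer as ℤ using (+_)
import Data.Integer.Properties as ℤ
open import Data.Rational as ℚ
  using (ℚ; 0ℚ; 1ℚ; ½; _+_; _*_; _-_; -_; _≤_; _<_; _/_; ∣_∣; ↧ₙ_; toℚᵘ; *≤*)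
import Data.Rational.Properties as ℚ
open import Data.Rational.Unnormalised as ℚᵘ using (mkℚᵘ; *≡*)
import Data.Rational.Unnormalised.Properties as ℚᵘ
open import Data.Rational.Solver using (module +-*-Solver)
open import Data.Fin using (Fin; toℕ; fromℕ<)
open import Data.List using ([]; _∷_; [_]; _++_; length; map; lookup; concat; concatMap; applyUpTo)
open import Data.List.Properties
  using (∷-injective; ++-assoc; length-++; length-applyUpTo; map-applyUpTo; concat-++; concatMap-++)
open import Data.Product using (∃-syntax; _×_; _,_; proj₁; proj₂)
open import Data.Sum using (inj₁; inj₂)
open import Function using (_∘_)
open import Function.Bundles using (_↔_)
open import Relation.Nullary using (contradiction)
open import Relation.Binary.PropositionalEquality
  using (_≡_; refl; sym; trans; cong; cong₂; subst; subst₂; module ≡-Reasoning)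

private variable
  A B : Set

-- Prefixes of infinite words

infix 4 _⊑_

-- Shaped like `Subword` at a fixed position, so that an occurrence at `i` in `w` is by definition a
-- prefix of `dropω i w`.
_⊑_ : Word A → InfWord A → Set
v ⊑ w = applyUpTo w (length v) ≡ v

dropω : ℕ → InfWord A → InfWord A
dropω k w j = w (k ℕ.+ j)

applyUpTo-+ : ∀ (w : InfWord A) m n →
              applyUpTo w (m ℕ.+ n) ≡ applyUpTo w m ++ applyUpTo (dropω m w) n
applyUpTo-+ w zero    n = refl
applyUpTo-+ w (suc m) n = cong (w 0 ∷_) (applyUpTo-+ (w ∘ suc) m n)

applyUpTo-injective : ∀ {v w : InfWord A} n → applyUpTo v n ≡ applyUpTo w n →
                      ∀ j → j ℕ.< n → v j ≡ w j
applyUpTo-injective (suc n) eq zero    j<n = proj₁ (∷-injective eq)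
applyUpTo-injective (suc n) eq (suc j) j<n =
  applyUpTo-injective n (proj₂ (∷-injective eq)) j (s<s⁻¹ j<n)

⊑-++⁻ : ∀ xs {ys : Word A} {w} → xs ++ ys ⊑ w → xs ⊑ w × ys ⊑ dropω (length xs) w
⊑-++⁻ []       ys⊑ = refl , ys⊑
⊑-++⁻ (x ∷ xs) eq with ∷-injective eq
... | x≡ , eq′ with ⊑-++⁻ xs eq′
... | xs⊑ , ys⊑ = cong₂ _∷_ x≡ xs⊑ , ys⊑

⊑-applyUpTo-++ : ∀ (w : InfWord A) i {v} → v ⊑ dropω i w → applyUpTo w i ++ v ⊑ w
⊑-applyUpTo-++ w i {v} v⊑ = begin
  applyUpTo w (length (applyUpTo w i ++ v))              ≡⟨ cong (applyUpTo w) (length-++ (applyUpTo w i)) ⟩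
  applyUpTo w (length (applyUpTo w i) ℕ.+ length v)      ≡⟨ cong (λ n → applyUpTo w (n ℕ.+ length v)) (length-applyUpTo w i) ⟩
  applyUpTo w (i ℕ.+ length v)                           ≡⟨ applyUpTo-+ w i (length v) ⟩
  applyUpTo w i ++ applyUpTo (dropω i w) (length v)      ≡⟨ cong (applyUpTo w i ++_) v⊑ ⟩
  applyUpTo w i ++ v                                     ∎
  where open ≡-Reasoning

⊑-comparable : ∀ {v v′ : Word A} {w} → v ⊑ w → v′ ⊑ w → length v ℕ.≤ length v′ →
               ∃[ t ] v′ ≡ v ++ t
⊑-comparable {v = v} {v′} {w} v⊑ v′⊑ v≤v′ = t , (begin
  v′                                                     ≡⟨ v′⊑ ⟨
  applyUpTo w (length v′)                                ≡⟨ cong (applyUpTo w) (ℕ.m+[n∸m]≡n v≤v′) ⟨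
  applyUpTo w (length v ℕ.+ (length v′ ℕ.∸ length v))    ≡⟨ applyUpTo-+ w (length v) _ ⟩
  applyUpTo w (length v) ++ t                            ≡⟨ cong (_++ t) v⊑ ⟩
  v ++ t                                                 ∎)
  where
  open ≡-Reasoning
  t = applyUpTo (dropω (length v) w) (length v′ ℕ.∸ length v)

-- The bounds are irrelevant, as in `fromℕ<`, so the letter read does not depend on the proof of the
-- bound that `concatω` supplies.
lookup-++ˡ : ∀ (xs ys : Word A) {i} .(i<xs : i ℕ.< length xs) .(i<xs++ys : i ℕ.< length (xs ++ ys)) →
             lookup (xs ++ ys) (fromℕ< i<xs++ys) ≡ lookup xs (fromℕ< i<xs)
lookup-++ˡ (x ∷ xs) ys {zero}  _ _    = refl
lookup-++ˡ (x ∷ xs) ys {suc i} i< i<′ = lookup-++ˡ xs ys (s<s⁻¹ i<) (s<s⁻¹ i<′)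

lookup⇒⊑ : ∀ {w : InfWord A} v →
           (∀ i .(i<v : i ℕ.< length v) → w i ≡ lookup v (fromℕ< i<v)) → v ⊑ w
lookup⇒⊑ []      eq = refl
lookup⇒⊑ (c ∷ v) eq =
  cong₂ _∷_ (eq 0 z<s) (lookup⇒⊑ v (λ i i<v → eq (suc i) (s<s i<v)))

-- Prefixes of infinite concatenations

module _ (b : ℕ → Word A) where

  concat-applyUpTo-≤ : ∀ {m n} → m ℕ.≤ n →
                       ∃[ t ] concat (applyUpTo b n) ≡ concat (applyUpTo b m) ++ t
  concat-applyUpTo-≤ {m} {n} m≤n = _ , (begin
    concat (applyUpTo b n)                       ≡⟨ cong (concat ∘ applyUpTo b) (ℕ.m+[n∸m]≡n m≤n) ⟨
    concat (applyUpTo b (m ℕ.+ (n ℕ.∸ m)))       ≡⟨ cong concat (applyUpTo-+ b m (n ℕ.∸ m)) ⟩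
    concat (applyUpTo b m ++ _)                  ≡⟨ concat-++ (applyUpTo b m) _ ⟨
    concat (applyUpTo b m) ++ _                  ∎)
    where open ≡-Reasoning

  lookup-concat-applyUpTo : ∀ {m n i} → m ℕ.≤ n →
    .(i<m : i ℕ.< length (concat (applyUpTo b m))) .(i<n : i ℕ.< length (concat (applyUpTo b n))) →
    lookup (concat (applyUpTo b n)) (fromℕ< i<n) ≡ lookup (concat (applyUpTo b m)) (fromℕ< i<m)
  lookup-concat-applyUpTo {m} {n} m≤n i<m i<n
    -- Once the longer concatenation is abstracted, matching on `refl` replaces it by the shorter
    -- one followed by `t`.
    with concat (applyUpTo b n) | concat-applyUpTo-≤ m≤n
  ... | _ | t , refl = lookup-++ˡ (concat (applyUpTo b m)) t i<m i<n

  -- `concatω` reads letter `i` off the first `i + 1` blocks. One of the concatenations of `i + 1`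
  -- and of `n` blocks extends the other, so they agree at `i`.
  concat-applyUpTo-⊑ : ∀ ne n → concat (applyUpTo b n) ⊑ concatω b ne
  concat-applyUpTo-⊑ ne n = lookup⇒⊑ (concat (applyUpTo b n)) agree
    where
    agree : ∀ i .(i<n : i ℕ.< length (concat (applyUpTo b n))) →
            concatω b ne i ≡ lookup (concat (applyUpTo b n)) (fromℕ< i<n)
    agree i i<n with ℕ.≤-total (suc i) n
    ... | inj₁ i≤n = sym (lookup-concat-applyUpTo i≤n (length-concat b ne (suc i)) i<n)
    ... | inj₂ n≤i = lookup-concat-applyUpTo n≤i i<n (length-concat b ne (suc i))

-- The first `length v` blocks of the image are the words g(c) for the letters c of `v`, and
-- together they spell g(v).
image-⊑ : ∀ (g : Morphism A B) ne {w v} → v ⊑ w → concatMap g v ⊑ image g ne w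
image-⊑ g ne {w} {v} v⊑ = subst (_⊑ image g ne w) (cong concat eq)
  (concat-applyUpTo-⊑ (g ∘ w) (ne ∘ w) (length v))
  where
  eq = trans (sym (map-applyUpTo w g (length v))) (cong (map g) v⊑)

-- Pure morphic words and lengths of images

module _ (φ : Morphism A A) (a : A) where

  iterate-⊑ : ∀ prolongable n → φ ^⟨ n ⟩ [ a ] ⊑ pureMorphic φ a prolongable
  iterate-⊑ (x , φa≡ax , imm) n =
    subst (_⊑ pureMorphic φ a (x , φa≡ax , imm)) (sym (iterates-converge φ a x φa≡ax n))
      (concat-applyUpTo-⊑ (blocks φ a x) (blocks-nonEmpty φ a x imm) (suc n))

  -- φⁿ(a) consists of `n + 1` non-empty blocks.
  length-iterate : Prolongable φ a → ∀ n → n ℕ.≤ length (φ ^⟨ n ⟩ [ a ])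
  length-iterate (x , φa≡ax , imm) n =
    subst (n ℕ.≤_) (sym (cong length (iterates-converge φ a x φa≡ax n)))
      (ℕ.≤-trans (ℕ.n≤1+n n) (length-concat (blocks φ a x) (blocks-nonEmpty φ a x imm) (suc n)))

  -- The invariance of w = φ^ω(a) under φ, in terms of finite words only. A prefix v of w begins
  -- φ^|v|(a), which is long enough; hence φⁿ(v) begins φ^(n+|v|)(a), again a prefix of w.
  ^⟨⟩-⊑ : ∀ prolongable n {v} → v ⊑ pureMorphic φ a prolongable →
          φ ^⟨ n ⟩ v ⊑ pureMorphic φ a prolongable
  ^⟨⟩-⊑ prolongable n {v} v⊑ =
    let t , eq = ⊑-comparable v⊑ (iterate-⊑ prolongable (length v)) (length-iterate prolongable (length v))
    in proj₁ (⊑-++⁻ (φ ^⟨ n ⟩ v)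
         (subst (_⊑ pureMorphic φ a prolongable) (iterate≡ eq) (iterate-⊑ prolongable (n ℕ.+ length v))))
    where
    open ≡-Reasoning
    iterate≡ : ∀ {t} → φ ^⟨ length v ⟩ [ a ] ≡ v ++ t →
               φ ^⟨ n ℕ.+ length v ⟩ [ a ] ≡ φ ^⟨ n ⟩ v ++ φ ^⟨ n ⟩ t
    iterate≡ {t} eq = begin
      φ ^⟨ n ℕ.+ length v ⟩ [ a ]       ≡⟨ fold-+ [ a ] (concatMap φ) n ⟩
      φ ^⟨ n ⟩ (φ ^⟨ length v ⟩ [ a ])  ≡⟨ cong (φ ^⟨ n ⟩_) eq ⟩
      φ ^⟨ n ⟩ (v ++ t)                 ≡⟨ ^⟨⟩-++ φ n v t ⟩
      φ ^⟨ n ⟩ v ++ φ ^⟨ n ⟩ t          ∎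

-- Each letter contributes at least one letter. This carries the growth of |φⁿ(u)| over to its image
-- under g.
length-concatMap : ∀ (g : Morphism A B) → NonErasing g → ∀ v → length v ℕ.≤ length (concatMap g v)
length-concatMap g ne []      = z≤n
length-concatMap g ne (c ∷ v) with g c in eq
... | []     = contradiction eq (ne c)
... | d ∷ ds = s≤s (ℕ.≤-trans (length-concatMap g ne v)
  (subst (length (concatMap g v) ℕ.≤_) (sym (length-++ ds)) (ℕ.m≤n+m _ (length ds))))

-- Periodicity from repetitions

⊑⇒≡ : ∀ {v w : InfWord A} {xs} → xs ⊑ v → xs ⊑ w →
      ∀ j → j ℕ.< length xs → v j ≡ w j
⊑⇒≡ {xs = xs} xs⊑v xs⊑w = applyUpTo-injective (length xs) (trans xs⊑v (sym xs⊑w))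

-- The block `xs ++ ys ++ xs` occurs both at the start and after the first `xs ++ ys`; the two
-- copies overlap in `xs` and are compared letter by letter.
xyxyx⊑⇒periodic : ∀ xs ys {w : InfWord A} → xs ++ ys ++ xs ++ ys ++ xs ⊑ w →
  ∀ j → j ℕ.< length (xs ++ ys) ℕ.+ length xs → w j ≡ w (length (xs ++ ys) ℕ.+ j)
xyxyx⊑⇒periodic xs ys {w} ⊑w j j< = ⊑⇒≡ {w = dropω (length (xs ++ ys)) w}
  (proj₁ (⊑-++⁻ (per ++ xs) (subst (_⊑ w) split ⊑w)))
  (proj₂ (⊑-++⁻ per (subst (_⊑ w) split′ ⊑w)))
  j (subst (j ℕ.<_) (sym (length-++ per)) j<)
  where
  per = xs ++ ys
  split′ : xs ++ ys ++ xs ++ ys ++ xs ≡ per ++ (per ++ xs)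
  split′ = trans (sym (++-assoc xs ys (xs ++ ys ++ xs))) (cong (per ++_) (sym (++-assoc xs ys xs)))
  split : xs ++ ys ++ xs ++ ys ++ xs ≡ (per ++ xs) ++ (ys ++ xs)
  split = trans (sym (++-assoc xs ys (xs ++ ys ++ xs))) (sym (++-assoc per xs (ys ++ xs)))

-- Rational arithmetic

ι : ℕ → ℚ
ι n = + n / 1

/-≡ : ∀ {a b c d} .{{_ : ℕ.NonZero b}} .{{_ : ℕ.NonZero d}} →
      a ℕ.* d ≡ c ℕ.* b → + a / b ≡ + c / d
/-≡ {a} {suc b} {c} {suc d} eq = ℚ.fromℚᵘ-cong {mkℚᵘ (+ a) b} {mkℚᵘ (+ c) d}
  (*≡* (trans (sym (ℤ.pos-* a (suc d))) (trans (cong +_ eq) (ℤ.pos-* c (suc b)))))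

/-* : ∀ a b c d .{{_ : ℕ.NonZero b}} .{{_ : ℕ.NonZero d}} .{{_ : ℕ.NonZero (b ℕ.* d)}} →
      (+ a / b) * (+ c / d) ≡ + (a ℕ.* c) / (b ℕ.* d)
/-* a b@(suc b-1) c d@(suc d-1) = ℚ.toℚᵘ-injective (begin-equality
  toℚᵘ ((+ a / b) * (+ c / d))          ≃⟨ ℚ.toℚᵘ-homo-* (+ a / b) (+ c / d) ⟩
  toℚᵘ (+ a / b) ℚᵘ.* toℚᵘ (+ c / d)    ≃⟨ ℚᵘ.*-cong (ℚ.toℚᵘ-fromℚᵘ (mkℚᵘ (+ a) b-1)) (ℚ.toℚᵘ-fromℚᵘ (mkℚᵘ (+ c) d-1)) ⟩
  mkℚᵘ (+ a ℤ.* + c) _                  ≡⟨ cong (λ z → mkℚᵘ z (d-1 ℕ.+ b-1 ℕ.* d)) (ℤ.pos-* a c) ⟨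
  mkℚᵘ (+ (a ℕ.* c)) _                  ≃⟨ ℚ.toℚᵘ-fromℚᵘ (mkℚᵘ (+ (a ℕ.* c)) _) ⟨
  toℚᵘ (+ (a ℕ.* c) / (b ℕ.* d))        ∎)
  where open ℚᵘ.≤-Reasoning

ι-+ : ∀ m n → ι (m ℕ.+ n) ≡ ι m + ι n
ι-+ m n = /1-+ (+ m) (+ n)

ι-* : ∀ m n → ι (m ℕ.* n) ≡ ι m * ι n
ι-* m n = sym (/-* m 1 n 1)

ι-nonNeg : ∀ n → ℚ.NonNegative (ι n)
ι-nonNeg n = ℚ.normalize-nonNeg n 1

ι-mono-≤ : ∀ {m n} → m ℕ.≤ n → ι m ≤ ι n
ι-mono-≤ {m} {n} m≤n rewrite /1 (+ m) | /1 (+ n) =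
  *≤* (subst₂ ℤ._≤_ (sym (ℤ.*-identityʳ (+ m))) (sym (ℤ.*-identityʳ (+ n))) (ℤ.+≤+ m≤n))

-- Powers of p and truncated base-p expansions

module _ {p : ℕ} (p-prime : Prime p) where
  open Expansion p-prime using (p^≢0; p^-_; partialSum; bounds; spread; n≤p^n; small)
  open Littlewood p-prime using (valuation; ∣_∣ₚ; littlewoodTerm)

  private instance
    p≢0 : ℕ.NonZero p
    p≢0 = prime⇒nonZero p-prime

  within⇒close : ∀ {s e x y} → s ≤ x → x ≤ s + e → s ≤ y → y ≤ s + e → ∣ x - y ∣ ≤ e
  within⇒close {x = x} {y} s≤x x≤s+e s≤y y≤s+e = abs-≤ (spread s≤y x≤s+e)
    (subst (_≤ _) (solve 2 (λ x y → y :- x := :- (x :- y)) refl x y) (spread s≤x y≤s+e))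
    where open +-*-Solver

  p*d/p^[1+n] : ∀ d n → ι p * (+ d / p ℕ.^ suc n) {{p^≢0 (suc n)}} ≡ (+ d / p ℕ.^ n) {{p^≢0 n}}
  p*d/p^[1+n] d n = trans
    (/-* p 1 d (p ℕ.^ suc n) {{_}} {{p^≢0 (suc n)}} {{ℕ.m*n≢0 1 (p ℕ.^ suc n) {{_}} {{p^≢0 (suc n)}}}})
    (/-≡ {p ℕ.* d} {1 ℕ.* p ℕ.^ suc n} {d} {p ℕ.^ n} {{ℕ.m*n≢0 1 (p ℕ.^ suc n) {{_}} {{p^≢0 (suc n)}}}} {{p^≢0 n}}
      (solve 3 (λ p d x → (p :* d) :* x := d :* (con 1 :* (p :* x))) refl p d (p ℕ.^ n)))
    where open ℕ.+-*-Solver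

  p^-+ : ∀ m n → p^- (m ℕ.+ n) ≡ p^- m * p^- n
  p^-+ m n = sym (trans
    (/-* 1 (p ℕ.^ m) 1 (p ℕ.^ n) {{p^≢0 m}} {{p^≢0 n}} {{nz}})
    (/-≡ {1} {p ℕ.^ m ℕ.* p ℕ.^ n} {1} {p ℕ.^ (m ℕ.+ n)} {{nz}} {{p^≢0 (m ℕ.+ n)}}
      (cong (1 ℕ.*_) (ℕ.^-distribˡ-+-* p m n))))
    where nz = ℕ.m*n≢0 (p ℕ.^ m) (p ℕ.^ n) {{p^≢0 m}} {{p^≢0 n}}

  p^n*p^-n : ∀ n → ι (p ℕ.^ n) * p^- n ≡ 1ℚ
  p^n*p^-n n = trans
    (/-* (p ℕ.^ n) 1 1 (p ℕ.^ n) {{_}} {{p^≢0 n}} {{nz}})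
    (/-≡ {p ℕ.^ n ℕ.* 1} {1 ℕ.* p ℕ.^ n} {1} {1} {{nz}}
      (solve 1 (λ x → (x :* con 1) :* con 1 := con 1 :* (con 1 :* x)) refl (p ℕ.^ n)))
    where
    open ℕ.+-*-Solver
    nz = ℕ.m*n≢0 1 (p ℕ.^ n) {{_}} {{p^≢0 n}}

  p^-nonNeg : ∀ n → ℚ.NonNegative (p^- n)
  p^-nonNeg n = ℚ.normalize-nonNeg 1 (p ℕ.^ n) {{p^≢0 n}}

  p^-≤1 : ∀ n → p^- n ≤ 1ℚ
  p^-≤1 n = begin
    p^- n                 ≡⟨ ℚ.*-identityˡ (p^- n) ⟨
    1ℚ * p^- n            ≤⟨ ℚ.*-monoʳ-≤-nonNeg (p^- n) {{p^-nonNeg n}} (ι-mono-≤ (ℕ.m^n>0 p n)) ⟩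
    ι (p ℕ.^ n) * p^- n   ≡⟨ p^n*p^-n n ⟩
    1ℚ                    ∎
    where open ℚ.≤-Reasoning

  p^-antitone : ∀ {m n} → m ℕ.≤ n → p^- n ≤ p^- m
  p^-antitone {m} {n} m≤n = begin
    p^- n                     ≡⟨ cong p^-_ (ℕ.m+[n∸m]≡n m≤n) ⟨
    p^- (m ℕ.+ (n ℕ.∸ m))     ≡⟨ p^-+ m (n ℕ.∸ m) ⟩
    p^- m * p^- (n ℕ.∸ m)     ≤⟨ ℚ.*-monoˡ-≤-nonNeg (p^- m) {{p^-nonNeg m}} (p^-≤1 (n ℕ.∸ m)) ⟩
    p^- m * 1ℚ                ≡⟨ ℚ.*-identityʳ (p^- m) ⟩
    p^- m                     ∎
    where open ℚ.≤-Reasoning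

  partialSum-cong : ∀ {v w} n → (∀ j → j ℕ.< n → v j ≡ w j) → partialSum v n ≡ partialSum w n
  partialSum-cong zero    eq = refl
  partialSum-cong (suc n) eq = cong₂ _+_ (partialSum-cong n (λ j j<n → eq j (ℕ.m<n⇒m<1+n j<n)))
    (cong (λ d → (+ toℕ d / p ℕ.^ suc n) {{p^≢0 (suc n)}}) (eq n (ℕ.n<1+n n)))

  partialSum-shift : ∀ v m → ι p * partialSum v (suc m) ≡ ι (toℕ (v 0)) + partialSum (v ∘ suc) m
  partialSum-shift v zero = begin
    ι p * (0ℚ + d/p)     ≡⟨ cong (ι p *_) (ℚ.+-identityˡ d/p) ⟩
    ι p * d/p            ≡⟨ p*d/p^[1+n] (toℕ (v 0)) 0 ⟩
    ι (toℕ (v 0))        ≡⟨ ℚ.+-identityʳ (ι (toℕ (v 0))) ⟨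
    ι (toℕ (v 0)) + 0ℚ   ∎
    where
    open ≡-Reasoning
    d/p = (+ toℕ (v 0) / p ℕ.^ 1) {{p^≢0 1}}
  partialSum-shift v (suc m) = begin
    ι p * (partialSum v (suc m) + d (suc (suc m)))
      ≡⟨ ℚ.*-distribˡ-+ (ι p) (partialSum v (suc m)) (d (suc (suc m))) ⟩
    ι p * partialSum v (suc m) + ι p * d (suc (suc m))
      ≡⟨ cong₂ _+_ (partialSum-shift v m) (p*d/p^[1+n] (toℕ (v (suc m))) (suc m)) ⟩
    ι (toℕ (v 0)) + partialSum (v ∘ suc) m + d (suc m)
      ≡⟨ ℚ.+-assoc (ι (toℕ (v 0))) (partialSum (v ∘ suc) m) (d (suc m)) ⟩
    ι (toℕ (v 0)) + partialSum (v ∘ suc) (suc m) ∎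
    where
    open ≡-Reasoning
    d = λ n → (+ toℕ (v (suc m)) / p ℕ.^ n) {{p^≢0 n}}

  -- The digit shift iterated `k` times. The integer `z` is spelled by the first `k` digits, hence
  -- is the same for every truncation.
  partialSum-dropω : ∀ v k → ∃[ z ] ∀ m →
    ι (p ℕ.^ k) * partialSum v (k ℕ.+ m) ≡ ι z + partialSum (dropω k v) m
  partialSum-dropω v zero    = 0 , λ m →
    trans (ℚ.*-identityˡ (partialSum v m)) (sym (ℚ.+-identityˡ (partialSum v m)))
  partialSum-dropω v (suc k) with partialSum-dropω (v ∘ suc) k
  -- Among `suc k` digits the leading one has place value p^k.
  ... | z , ih = p ℕ.^ k ℕ.* toℕ (v 0) ℕ.+ z , λ m → begin
    ι (p ℕ.* p ℕ.^ k) * partialSum v (suc (k ℕ.+ m))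
      ≡⟨ cong (_* partialSum v (suc (k ℕ.+ m))) (ι-* p (p ℕ.^ k)) ⟩
    ι p * ι (p ℕ.^ k) * partialSum v (suc (k ℕ.+ m))
      ≡⟨ solve 3 (λ a b c → (a :* b) :* c := b :* (a :* c)) refl (ι p) (ι (p ℕ.^ k)) (partialSum v (suc (k ℕ.+ m))) ⟩
    ι (p ℕ.^ k) * (ι p * partialSum v (suc (k ℕ.+ m)))
      ≡⟨ cong (ι (p ℕ.^ k) *_) (partialSum-shift v (k ℕ.+ m)) ⟩
    ι (p ℕ.^ k) * (ι (toℕ (v 0)) + partialSum (v ∘ suc) (k ℕ.+ m))
      ≡⟨ ℚ.*-distribˡ-+ (ι (p ℕ.^ k)) (ι (toℕ (v 0))) _ ⟩
    ι (p ℕ.^ k) * ι (toℕ (v 0)) + ι (p ℕ.^ k) * partialSum (v ∘ suc) (k ℕ.+ m)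
      ≡⟨ cong₂ _+_ (sym (ι-* (p ℕ.^ k) (toℕ (v 0)))) (ih m) ⟩
    ι (p ℕ.^ k ℕ.* toℕ (v 0)) + (ι z + partialSum (dropω (suc k) v) m)
      ≡⟨ ℚ.+-assoc (ι (p ℕ.^ k ℕ.* toℕ (v 0))) (ι z) _ ⟨
    ι (p ℕ.^ k ℕ.* toℕ (v 0)) + ι z + partialSum (dropω (suc k) v) m
      ≡⟨ cong (_+ partialSum (dropω (suc k) v) m) (ι-+ (p ℕ.^ k ℕ.* toℕ (v 0)) z) ⟨
    ι (p ℕ.^ k ℕ.* toℕ (v 0) ℕ.+ z) + partialSum (dropω (suc k) v) m ∎
    where
    open ≡-Reasoning
    open +-*-Solver

  -- Bounds for a single term

  ∣q∣ₚ≤p^- : ∀ {r} q .{{_ : ℕ.NonZero q}} → p ℕ.^ r ℕ.∣ q → ∣ q ∣ₚ ≤ p^- r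
  ∣q∣ₚ≤p^- {r} q p^r∣q with valuation q
  -- If k < r, then p^(k+1) would divide p^r and therefore q, against the maximality of k.
  ... | k , _ , p^[1+k]∤q = p^-antitone {r} {k} (ℕ.≮⇒≥ λ k<r → p^[1+k]∤q (ℕ.∣-trans (p^-∣ k<r) p^r∣q))
    where
    p^-∣ : ∀ {m n} → m ℕ.≤ n → p ℕ.^ m ℕ.∣ p ℕ.^ n
    p^-∣ {m} {n} m≤n = subst (p ℕ.^ m ℕ.∣_)
      (trans (sym (ℕ.^-distribˡ-+-* p m (n ℕ.∸ m))) (cong (p ℕ.^_) (ℕ.m+[n∸m]≡n m≤n)))
      (ℕ.m∣m*n (p ℕ.^ (n ℕ.∸ m)))

  ∣q∣ₚ-nonNeg : ∀ q .{{_ : ℕ.NonZero q}} → ℚ.NonNegative ∣ q ∣ₚ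
  ∣q∣ₚ-nonNeg q = p^-nonNeg (proj₁ (valuation q))

  littlewoodTerm-nonNeg : ∀ x q .{{_ : ℕ.NonZero q}} n → 0ℚ ≤ littlewoodTerm x q .approx n
  littlewoodTerm-nonNeg x q n = 0≤* (ι q) (ι-nonNeg q) (0≤* ∣ q ∣ₚ (∣q∣ₚ-nonNeg q) (ℚ.0≤∣p∣ (qx - ℚ.round qx / 1)))
    where
    qx = ι q * x .approx n
    0≤* : ∀ c {y} → ℚ.NonNegative c → 0ℚ ≤ y → 0ℚ ≤ c * y
    0≤* c {y} c≥0 0≤y = subst (_≤ c * y) (ℚ.*-zeroʳ c) (ℚ.*-monoˡ-≤-nonNeg c {{c≥0}} 0≤y)

  -- Up to integers, q times a truncation is the difference of two tails of the expansion. These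
  -- share `m` leading digits and so lie in one interval of length p^-m. The equation for q is
  -- additive to avoid truncated subtraction.
  ‖qx‖-≤ : ∀ v r l m q → q ℕ.+ p ℕ.^ r ≡ p ℕ.^ (r ℕ.+ l) →
           (∀ j → j ℕ.< m → v (r ℕ.+ j) ≡ v (r ℕ.+ l ℕ.+ j)) →
           ∀ n → r ℕ.+ (l ℕ.+ m) ℕ.≤ n → ‖ ι q * partialSum v n ‖ℚ ≤ p^- m
  ‖qx‖-≤ v r l m q q≡ agree n large = subst (λ n → ‖ ι q * partialSum v n ‖ℚ ≤ p^- m) n≡ (begin
    -- Any integer bounds the distance from above, so z₁ - z₀ need not be the nearest one.
    ‖ ι q * S ‖ℚ                                        ≤⟨ ‖‖-nearest (ι q * S) (+ z₁ ℤ.- + z₀) ⟩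
    ∣ ι q * S - (+ z₁ ℤ.- + z₀) / 1 ∣                   ≡⟨ cong ∣_∣ difference ⟩
    ∣ y₁ - y₀ ∣                                         ≤⟨ within⇒close lower₁ upper₁ (proj₁ bounds₀) (proj₂ bounds₀) ⟩
    p^- m                                               ∎)
    where
    k = n ℕ.∸ (r ℕ.+ (l ℕ.+ m))
    n≡ : r ℕ.+ l ℕ.+ (m ℕ.+ k) ≡ n
    n≡ = trans (solve 4 (λ r l m k → r :+ l :+ (m :+ k) := (r :+ (l :+ m)) :+ k) refl r l m k)
               (ℕ.m+[n∸m]≡n large)
      where open ℕ.+-*-Solver
    S = partialSum v (r ℕ.+ l ℕ.+ (m ℕ.+ k))
    z₀ = proj₁ (partialSum-dropω v r)
    z₁ = proj₁ (partialSum-dropω v (r ℕ.+ l))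
    -- Both tails come from the same truncation `S`, so y₀ has `l` more digits than y₁; each has at
    -- least `m`.
    y₀ = partialSum (dropω r v) (l ℕ.+ (m ℕ.+ k))
    y₁ = partialSum (dropω (r ℕ.+ l) v) (m ℕ.+ k)
    p^r*S : ι (p ℕ.^ r) * S ≡ ι z₀ + y₀
    p^r*S = trans (cong (λ n → ι (p ℕ.^ r) * partialSum v n) (ℕ.+-assoc r l (m ℕ.+ k)))
                  (proj₂ (partialSum-dropω v r) (l ℕ.+ (m ℕ.+ k)))
    p^[r+l]*S : (ι q + ι (p ℕ.^ r)) * S ≡ ι z₁ + y₁
    p^[r+l]*S = trans (cong (_* S) (trans (sym (ι-+ q (p ℕ.^ r))) (cong ι q≡)))
                      (proj₂ (partialSum-dropω v (r ℕ.+ l)) (m ℕ.+ k))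
    difference : ι q * S - (+ z₁ ℤ.- + z₀) / 1 ≡ y₁ - y₀
    difference = begin
      ι q * S - (+ z₁ ℤ.- + z₀) / 1
        ≡⟨ cong (λ z → ι q * S - z) (trans (/1-+ (+ z₁) (ℤ.- + z₀)) (cong (λ t → ι z₁ + t) (/1-neg (+ z₀)))) ⟩
      ι q * S - (ι z₁ - ι z₀)
        ≡⟨ solve 5 (λ q P S z₁ z₀ → q :* S :- (z₁ :- z₀) := ((q :+ P) :* S :- z₁) :- (P :* S :- z₀))
             refl (ι q) (ι (p ℕ.^ r)) S (ι z₁) (ι z₀) ⟩
      ((ι q + ι (p ℕ.^ r)) * S - ι z₁) - (ι (p ℕ.^ r) * S - ι z₀)
        ≡⟨ cong₂ (λ s t → (s - ι z₁) - (t - ι z₀)) p^[r+l]*S p^r*S ⟩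
      ((ι z₁ + y₁) - ι z₁) - ((ι z₀ + y₀) - ι z₀)
        ≡⟨ solve 4 (λ z₁ y₁ z₀ y₀ → ((z₁ :+ y₁) :- z₁) :- ((z₀ :+ y₀) :- z₀) := y₁ :- y₀)
             refl (ι z₁) y₁ (ι z₀) y₀ ⟩
      y₁ - y₀ ∎
      where
      open ≡-Reasoning
      open +-*-Solver
    bounds₀ = bounds (dropω r v) {m} (ℕ.≤-trans (ℕ.m≤m+n m k) (ℕ.m≤n+m (m ℕ.+ k) l))
    bounds₁ = bounds (dropω (r ℕ.+ l) v) {m} (ℕ.m≤m+n m k)
    agree′ : partialSum (dropω (r ℕ.+ l) v) m ≡ partialSum (dropω r v) m
    agree′ = sym (partialSum-cong m agree)
    lower₁ : partialSum (dropω r v) m ≤ y₁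
    lower₁ = subst (_≤ y₁) agree′ (proj₁ bounds₁)
    upper₁ : y₁ ≤ partialSum (dropω r v) m + p^- m
    upper₁ = subst (λ s → y₁ ≤ s + p^- m) agree′ (proj₂ bounds₁)
    open ℚ.≤-Reasoning

  -- The three factors are at most p^(r+l), p^-r and p^-(l+m), and the exponents add up to -m.
  littlewoodTerm-≤ : ∀ v r l m q .{{_ : ℕ.NonZero q}} → q ℕ.+ p ℕ.^ r ≡ p ℕ.^ (r ℕ.+ l) →
    (∀ j → j ℕ.< l ℕ.+ m → v (r ℕ.+ j) ≡ v (r ℕ.+ l ℕ.+ j)) →
    ∀ n → r ℕ.+ (l ℕ.+ (l ℕ.+ m)) ℕ.≤ n → littlewoodTerm (value p-prime v) q .approx n ≤ p^- m
  littlewoodTerm-≤ v r l m q q≡ agree n large = begin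
    ι q * (∣ q ∣ₚ * ‖qx‖)
      ≤⟨ ℚ.*-monoˡ-≤-nonNeg (ι q) {{ι-nonNeg q}}
           (ℚ.*-monoˡ-≤-nonNeg ∣ q ∣ₚ {{∣q∣ₚ-nonNeg q}} (‖qx‖-≤ v r l (l ℕ.+ m) q q≡ agree n large)) ⟩
    ι q * (∣ q ∣ₚ * p^- (l ℕ.+ m))
      ≤⟨ ℚ.*-monoˡ-≤-nonNeg (ι q) {{ι-nonNeg q}}
           (ℚ.*-monoʳ-≤-nonNeg (p^- (l ℕ.+ m)) {{p^-nonNeg (l ℕ.+ m)}} (∣q∣ₚ≤p^- {r} q p^r∣q)) ⟩
    ι q * (p^- r * p^- (l ℕ.+ m))
      ≡⟨ cong (ι q *_) (trans (sym (p^-+ r (l ℕ.+ m))) (trans (cong p^-_ (sym (ℕ.+-assoc r l m))) (p^-+ (r ℕ.+ l) m))) ⟩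
    ι q * (p^- (r ℕ.+ l) * p^- m)
      ≡⟨ ℚ.*-assoc (ι q) (p^- (r ℕ.+ l)) (p^- m) ⟨
    ι q * p^- (r ℕ.+ l) * p^- m
      ≤⟨ ℚ.*-monoʳ-≤-nonNeg (p^- m) {{p^-nonNeg m}}
           (ℚ.*-monoʳ-≤-nonNeg (p^- (r ℕ.+ l)) {{p^-nonNeg (r ℕ.+ l)}} (ι-mono-≤ (subst (q ℕ.≤_) q≡ (ℕ.m≤m+n q (p ℕ.^ r))))) ⟩
    ι (p ℕ.^ (r ℕ.+ l)) * p^- (r ℕ.+ l) * p^- m
      ≡⟨ cong (_* p^- m) (p^n*p^-n (r ℕ.+ l)) ⟩
    1ℚ * p^- m
      ≡⟨ ℚ.*-identityˡ (p^- m) ⟩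
    p^- m ∎
    where
    open ℚ.≤-Reasoning
    ‖qx‖ = ‖ ι q * partialSum v n ‖ℚ
    p^r∣q : p ℕ.^ r ℕ.∣ q
    -- p^r divides both p^r + q = p^r p^l and p^r, hence q.
    p^r∣q = ℕ.∣m+n∣m⇒∣n
      (subst (p ℕ.^ r ℕ.∣_) (trans (sym (ℕ.^-distribˡ-+-* p r l)) (trans (sym q≡) (ℕ.+-comm q (p ℕ.^ r))))
        (ℕ.m∣m*n (p ℕ.^ l)))
      ℕ.∣-refl

  -- The limit inferior

  nonNeg⇒0≤ℝ : ∀ x → (∀ n → 0ℚ ≤ x .approx n) → 0ℝ ≤ℝ x
  nonNeg⇒0≤ℝ x 0≤x (ε , 0<ε , N , x+ε≤0) = ℚ.<-irrefl refl (ℚ.<-≤-trans 0<ε (ℚ.≤-trans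
    (subst (_≤ x .approx N + ε) (ℚ.+-identityˡ ε) (ℚ.+-monoˡ-≤ ε (0≤x N))) (x+ε≤0 N ℕ.≤-refl)))

  -- All terms are non-negative, so the infima of the tails can be given outright as 0.
  repetitions⇒PLC : ∀ v →
    (∀ K → ∃[ r ] ∃[ l ] ∃[ m ] (K ℕ.≤ m × m ℕ.≤ l ×
       (∀ j → j ℕ.< l ℕ.+ m → v (r ℕ.+ j) ≡ v (r ℕ.+ l ℕ.+ j)))) →
    SatisfiesPLC p-prime (value p-prime v)
  repetitions⇒PLC v repetitions =
    (λ _ → 0ℝ) ,
    (λ N → (λ j → nonNeg⇒0≤ℝ (littlewoodTerm (value p-prime v) (suc (N ℕ.+ j)))
      (littlewoodTerm-nonNeg (value p-prime v) (suc (N ℕ.+ j)))) , approach N) ,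
    (λ _ → nonNeg⇒0≤ℝ 0ℝ (λ _ → ℚ.≤-refl)) ,
    (λ y y<0 → 0 , y<0)
    where
    approach : ∀ N y → 0ℝ <ℝ y → ∃[ j ] littlewoodTerm (value p-prime v) (suc (N ℕ.+ j)) <ℝ y
    approach N y (ε , 0<ε , N₀ , ε≤y)
      -- The first summand forces p^-m ≤ ε/2; the second makes q large enough to index a term of the
      -- tail from `N` on.
      with r , l , m , K≤m , m≤l , agree ← repetitions (↧ₙ (ε * ½) ℕ.+ suc (suc N))
      = j , δ , 0<δ , N₁ ℕ.⊔ N₀ , λ n large → begin
        littlewoodTerm (value p-prime v) (suc (N ℕ.+ j)) .approx n + δ
          ≤⟨ ℚ.+-monoˡ-≤ δ (littlewoodTerm-≤ v r l m (suc (N ℕ.+ j)) q+p^r agree n (ℕ.m⊔n≤o⇒m≤o N₁ N₀ large)) ⟩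
        p^- m + δ      ≤⟨ ℚ.+-monoˡ-≤ δ (ℚ.≤-trans (p^-antitone (ℕ.m+n≤o⇒m≤o (↧ₙ δ) K≤m)) (small δ 0<δ)) ⟩
        δ + δ          ≡⟨ solve 1 (λ e → e :* con ½ :+ e :* con ½ := con 0ℚ :+ e) refl ε ⟩
        0ℚ + ε         ≤⟨ ε≤y n (ℕ.m⊔n≤o⇒n≤o N₁ N₀ large) ⟩
        y .approx n    ∎
      where
      open ℚ.≤-Reasoning
      open +-*-Solver
      -- One half of ε bounds the term, the other is the gap that `_<ℝ_` asks for.
      δ = ε * ½
      0<δ : 0ℚ < δ
      0<δ = subst (_< δ) (ℚ.*-zeroˡ ½) (ℚ.*-monoˡ-<-pos ½ 0<ε)
      N₁ = r ℕ.+ (l ℕ.+ (l ℕ.+ m))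
      q = p ℕ.^ (r ℕ.+ l) ℕ.∸ p ℕ.^ r
      -- The sequence at index i holds the term for i + 1, so `suc (N + j)` has to equal `q`.
      j = q ℕ.∸ suc N
      N+2≤p^l : suc (suc N) ℕ.≤ p ℕ.^ l
      N+2≤p^l = ℕ.≤-trans (ℕ.m+n≤o⇒n≤o (↧ₙ δ) K≤m) (ℕ.≤-trans m≤l (n≤p^n l))
      N+1+p^r≤ : suc N ℕ.+ p ℕ.^ r ℕ.≤ p ℕ.^ (r ℕ.+ l)
      -- (N + 1) + p^r ≤ p^r (N + 1) + p^r = p^r (N + 2) ≤ p^r p^l. Hence q ≥ N + 1, and the
      -- subtractions defining `q` and `j` are exact.
      N+1+p^r≤ = ℕ.≤-trans (ℕ.+-monoˡ-≤ (p ℕ.^ r) (ℕ.m≤n*m (suc N) (p ℕ.^ r) {{p^≢0 r}}))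
        (subst₂ ℕ._≤_
          (trans (ℕ.*-suc (p ℕ.^ r) (suc N)) (ℕ.+-comm (p ℕ.^ r) _)) (sym (ℕ.^-distribˡ-+-* p r l))
          (ℕ.*-monoʳ-≤ (p ℕ.^ r) N+2≤p^l))
      q+p^r : suc (N ℕ.+ j) ℕ.+ p ℕ.^ r ≡ p ℕ.^ (r ℕ.+ l)
      q+p^r = trans (cong (ℕ._+ p ℕ.^ r) (ℕ.m+[n∸m]≡n (ℕ.m+n≤o⇒m≤o∸n (suc N) N+1+p^r≤)))
        (ℕ.m∸n+n≡m (ℕ.m+n≤o⇒n≤o (suc N) N+1+p^r≤))

proposition2p8 : (p : ℕ) (p-prime : Prime p)
    (A : Set) (k : ℕ) → A ↔ Fin k →
    (φ : Morphism A A) (a : A) (prolongable : Prolongable φ a) →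
    (u : A) (X : Word A) →
    Subword ([ u ] ++ X ++ [ u ] ++ X ++ [ u ]) (pureMorphic φ a prolongable) →
    TendsToInfinity (λ n → length (φ ^⟨ n ⟩ [ u ])) →
    (g : Morphism A (Fin p)) (nonErasing : NonErasing g) →
    SatisfiesPLC p-prime (value p-prime (image g nonErasing (pureMorphic φ a prolongable)))
proposition2p8 p p-prime A k A↔Fin φ a prolongable u X (i , uXuXu⊑) φⁿu→∞ g nonErasing =
  repetitions⇒PLC p-prime gw λ K →
    let n , K≤ = φⁿu→∞ K
        h : Word A → Word (Fin p)
        h v = concatMap g (φ ^⟨ n ⟩ v)
        h-++ : ∀ v v′ → h (v ++ v′) ≡ h v ++ h v′
        h-++ v v′ = trans (cong (concatMap g) (^⟨⟩-++ φ n v v′)) (concatMap-++ g (φ ^⟨ n ⟩ v) (φ ^⟨ n ⟩ v′))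
        -- The occurrence is completed to a prefix of w, because invariance under φⁿ is available
        -- for prefixes.
        V = applyUpTo w i
        U = [ u ]
        h-uXuXu : h (V ++ U ++ X ++ U ++ X ++ U) ≡ h V ++ h U ++ h X ++ h U ++ h X ++ h U
        h-uXuXu =
          trans (h-++ V _) (cong (h V ++_)
          (trans (h-++ U _) (cong (h U ++_)
          (trans (h-++ X _) (cong (h X ++_)
          (trans (h-++ U _) (cong (h U ++_) (h-++ X U))))))))
        hVuXuXu⊑ : h V ++ h U ++ h X ++ h U ++ h X ++ h U ⊑ gw
        hVuXuXu⊑ = subst (_⊑ gw) h-uXuXu
          (image-⊑ g nonErasing (^⟨⟩-⊑ φ a prolongable n (⊑-applyUpTo-++ w i uXuXu⊑)))
        r = length (h V)
        l = length (h U ++ h X)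
        m = length (h U)
    in r , l , m
     , ℕ.≤-trans (K≤ n ℕ.≤-refl) (length-concatMap g nonErasing (φ ^⟨ n ⟩ U))
     , subst (m ℕ.≤_) (sym (length-++ (h U))) (ℕ.m≤m+n m (length (h X)))
     -- Behind h(V) the word g(w) begins with xyxyx for x = h(u) and y = h(X), which has period `l`
     -- over `l + m` positions.
     , λ j j< → trans (xyxyx⊑⇒periodic (h U) (h X) (proj₂ (⊑-++⁻ (h V) hVuXuXu⊑)) j j<)
                      (cong gw (sym (ℕ.+-assoc r l j)))
  where
  w = pureMorphic φ a prolongable
  gw = image g nonErasing w
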